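{- Let $\mathcal{U}$ be the smallest family of sets of strings over $\{0,1,2,3\}$ such that (1) the two $1$-dimensional USOs $\{0,2\}$ and $\{1,3\}$ belong to $\mathcal{U}$; and (2) whenever $d\ge 1$ and $i\ge 1$, $\left(S^{(0)}_{1,\ldots,i},S^{(1)}_{1,\ldots,i},S^{(2)}_{1,\ldots,i},S^{(3)}_{1,\ldots,i}\right)$ is a generalized rewriting rule with $S^{(m)}_j\subseteq\{0,1,2,3\}^d$, each $S^{(m)}_j$ is a partial orientation of an already obtained USO (that is, for all $m\in\{0,1,2,3\}$ and $j\in[i]$ there is some $U\in\mathcal{U}$ with $U\subseteq\{0,1,2,3\}^d$ and $S^{(m)}_j\subseteq U$), $L:B\to[i]$ is any labelling of the bow $B=\{01,20,03,22\}$, and $h\in\{1,2\}$, then the set $T_h(B,L)\subseteq\{0,1,2,3\}^{d+1}$ obtained by applying the rule to the bow belongs to $\mathcal{U}$. Then for every $n\ge 1$, every $n$-dimensional USO (as a set of strings in $\{0,1,2,3\}^n$) belongs to $\mathcal{U}$. In other words, every USO of dimension $n\ge1$ can be generated from the two $1$-dimensional USOs by repeated application of generalized rewriting rules to the bow, where the sets used in each rule are partial orientations taken from already obtained USOs.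
   Context: Hypercubes and USOs. $[k]=\{1,\ldots,k\}$. $Q_k$ is the $k$-dimensional hypercube graph with vertex set $\{0,1\}^k$; $v\oplus i$ denotes the neighbor of $v$ differing from $v$ exactly in coordinate $i$, and $\{v,v\oplus i\}$ is an $i$-edge. An orientation $O$ of $Q_k$ directs every edge; it is identified with the function $O:\{0,1\}^k\to\{0,1\}^k$ where $O(v)_i=1$ if the edge $\{v,v\oplus i\}$ is directed upwards (from its endpoint with $i$-th coordinate $0$ to its endpoint with $i$-th coordinate $1$) and $O(v)_i=0$ if it is directed downwards (so $O(v)_i=O(v\oplus i)_i$). A face is the subgraph induced by all vertices that agree with a fixed string $f\in\{0,1,*\}^k$ on the non-$*$ positions. $O$ is a Unique Sink Orientation (USO) if every face contains exactly one vertex with no outgoing edges inside that face. String encoding. An orientation $O$ of $Q_k$ is encoded as the set of $2^k$ strings $\{p(v): v\in\{0,1\}^k\}\subseteq\{0,1,2,3\}^k$ with $p(v)_i=2v_i+O(v)_i$. A set $K\subseteq\{0,1,2,3\}^k$ is said to be (or define) a $k$-dimensional USO if it is the encoding of some USO of $Q_k$. A partial orientation of a USO corresponds to a subset of its set of strings (possibly empty). Generalized rewriting rule. For $i\ge1$, a generalized rewriting rule consists of sets $S^{(m)}_j\subseteq\{0,1,2,3\}^d$ ($m\in\{0,1,2,3\}$, $j\in[i]$) such that for all $j,j'\in[i]$: (i) $S^{(0)}_j\cap S^{(2)}_{j'}=\emptyset$ and $S^{(0)}_j\cup S^{(2)}_{j'}$ defines a $d$-dimensional USO; (ii) $S^{(1)}_j\cap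 S^{(3)}_{j'}=\emptyset$ and $S^{(1)}_j\cup S^{(3)}_{j'}$ defines a $d$-dimensional USO. For $K\subseteq\{0,1,2,3\}^k$, a labelling $L:K\to[i]$ and $h\in[k]$, applying the rule to $K$ on dimension $h$ gives $$T_h(K,L)=\bigcup_{v\in K}\left\{v_1\cdots v_{h-1}\,t_1\cdots t_d\,v_{h+1}\cdots v_k \;\middle|\; t\in S^{(v_h)}_{L(v)}\right\}\subseteq\{0,1,2,3\}^{k+d-1}.$$ -}

module Defs where

open import Data.Fin using (Fin; zero; suc; opposite; combine)
open import Data.Fin.Patterns using (0F; 1F; 2F; 3F)
open import Data.List as List using (List)
import Data.List.Membership.Propositional as List∈
open import Data.Maybe using (Maybe; just)
open import Data.Nat using (ℕ; suc; _+_; _≤_)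
open import Data.Nat.Properties using (+-comm)
open import Data.Product using (Σ-syntax; ∃-syntax; ∃!; _×_)
open import Data.Sum using (_⊎_)
open import Data.Vec using (Vec; []; _∷_; _++_; lookup; updateAt; zipWith; cast)
open import Level using (0ℓ) renaming (suc to lsuc)
open import Relation.Binary.PropositionalEquality using (_≡_)
open import Relation.Nullary using (¬_)
open import Relation.Unary using (Pred; _∈_; _⊆_; _≐_; _∪_; _⊥_)

Vertex : ℕ → Set
Vertex k = Vec (Fin 2) k

infixl 6 _⊕_
_⊕_ : ∀ {k} → Vertex k → Fin k → Vertex k
v ⊕ i = updateAt v i opposite

-- lookup (dir v) i ≡ 1F means that the i-edge at v points from its endpoint
-- with i-th coordinate 0 to its endpoint with i-th coordinate 1.
record Orientation (k : ℕ) : Set where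
  field
    dir        : Vertex k → Vertex k
    consistent : ∀ v i → lookup (dir v) i ≡ lookup (dir (v ⊕ i)) i

open Orientation public

Outgoing : ∀ {k} → Orientation k → Vertex k → Fin k → Set
Outgoing O v i = (lookup v i ≡ 0F × lookup (dir O v) i ≡ 1F)
               ⊎ (lookup v i ≡ 1F × lookup (dir O v) i ≡ 0F)

-- A string in {0,1,*}ᵏ, with nothing for *, describes a face by its vertices.
Face : ∀ {k} → Vec (Maybe (Fin 2)) k → Pred (Vertex k) 0ℓ
Face f v = ∀ i b → lookup f i ≡ just b → lookup v i ≡ b

-- Faces are induced subgraphs, so the i-edge at v ∈ Face f lies inside the
-- face exactly when v ⊕ i ∈ Face f.
SinkOf : ∀ {k} → Orientation k → Vec (Maybe (Fin 2)) k → Pred (Vertex k) 0ℓ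
SinkOf O f v = v ∈ Face f × (∀ i → v ⊕ i ∈ Face f → ¬ Outgoing O v i)

UniqueSink : ∀ {k} → Orientation k → Set
UniqueSink O = ∀ f → ∃! _≡_ (SinkOf O f)

Str : ℕ → Set
Str k = Vec (Fin 4) k

StringSet : ℕ → Set₁
StringSet k = Pred (Str k) 0ℓ

⟪_⟫ : ∀ {k} → List (Str k) → StringSet k
⟪ ss ⟫ s = s List∈.∈ ss

-- toℕ (combine a b) ≡ 2 * toℕ a + toℕ b for a b : Fin 2.
encode : ∀ {k} → Orientation k → Vertex k → Str k
encode O v = zipWith combine v (dir O v)

Encoding : ∀ {k} → Orientation k → StringSet k
Encoding O s = ∃[ v ] s ≡ encode O v

IsUSO : ∀ {k} → Pred (StringSet k) 0ℓ
IsUSO {k} K = Σ[ O ∈ Orientation k ] UniqueSink O × K ≐ Encoding O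

record RewritingRule (d i : ℕ) : Set₁ where
  field
    S          : Fin 4 → Fin i → StringSet d
    disjoint₀₂ : ∀ j j′ → S 0F j ⊥ S 2F j′
    uso₀₂      : ∀ j j′ → IsUSO (S 0F j ∪ S 2F j′)
    disjoint₁₃ : ∀ j j′ → S 1F j ⊥ S 3F j′
    uso₁₃      : ∀ j j′ → IsUSO (S 1F j ∪ S 3F j′)

open RewritingRule public

-- The membership proof is irrelevant, so that a label depends only on the
-- string and not on how it is shown to lie in K.
Labelling : ∀ {k} → StringSet k → ℕ → Set
Labelling K i = ∀ v → .(v ∈ K) → Fin i

-- splice h v t is v₁ ⋯ vₕ₋₁ t₁ ⋯ t_d vₕ₊₁ ⋯ vₖ₊₁.
splice : ∀ {A : Set} {k d} → Fin (suc k) → Vec A (suc k) → Vec A d → Vec A (k + d)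
splice {k = k} {d} zero (_ ∷ xs) t = cast (+-comm d k) (t ++ xs)
splice {k = suc _} (suc h) (x ∷ xs) t = x ∷ splice h xs t

apply : ∀ {k d i} → RewritingRule d i → Fin (suc k) →
        (K : StringSet (suc k)) → Labelling K i → StringSet (k + d)
apply {d = d} R h K L s =
  ∃[ v ] Σ[ v∈K ∈ v ∈ K ] Σ[ t ∈ Str d ]
    (t ∈ S R (lookup v h) (L v v∈K) × s ≡ splice h v t)

bow : StringSet 2
bow = ⟪ (0F ∷ 1F ∷ []) List.∷ (2F ∷ 0F ∷ []) List.∷
        (0F ∷ 3F ∷ []) List.∷ (2F ∷ 2F ∷ []) List.∷ List.[] ⟫

-- Sets of strings are predicates, whose equality is ≐ rather than ≡; the
-- constructor resp makes membership in 𝒰 depend only on the set.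
data 𝒰 : ∀ {n} → Pred (StringSet n) (lsuc 0ℓ) where
  base₀₂      : ⟪ (0F ∷ []) List.∷ (2F ∷ []) List.∷ List.[] ⟫ ∈ 𝒰
  base₁₃      : ⟪ (1F ∷ []) List.∷ (3F ∷ []) List.∷ List.[] ⟫ ∈ 𝒰
  rewrite-bow : ∀ {d i} → 1 ≤ d → 1 ≤ i → (R : RewritingRule d i) →
                (∀ m j → Σ[ U ∈ StringSet d ] U ∈ 𝒰 × S R m j ⊆ U) →
                (L : Labelling bow i) (h : Fin 2) → apply R h bow L ∈ 𝒰
  resp        : ∀ {n} {K K′ : StringSet n} → K ≐ K′ → K ∈ 𝒰 → K′ ∈ 𝒰

{-# OPTIONS --safe #-}
-- Fix the last coordinate of a USO O of dimension d + 1.  Its two facets are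
-- USOs U₀ and U₁, and every vertex u of the d-cube has a direction e(u), that of
-- the last-coordinate edge over u.  Applying a rule to the bow on dimension 1
-- reproduces O when Sᵐⱼ is the part of Uⱼ where e is up (m = 0, 1) or down
-- (m = 2, 3).  What has to be checked is that taking, at each u, the strings of
-- the facet g(e(u)) is again a USO for every g : {0,1} → {0,1}.  The reason: for
-- a face F of the d-cube the sinks of F in U₀ and in U₁ have the same e-value ε
-- (else both or neither would be a sink of F × {0,1}), so the sink of F in U_{g(ε)}
-- is the unique sink of F in the mixed orientation.
module Submission where

open import Defs
open import Data.Fin using (Fin; zero; suc; opposite; combine; quotient; punchIn; fromℕ)
open import Data.Fin.Patterns using (0F; 1F)
open import Data.Fin.Properties using (_≟_; 0≢1+n; combine-injectiveˡ)
open import Data.List as List using ()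
open import Data.List.Relation.Unary.Any using (here; there)
open import Data.Maybe using (Maybe; just; nothing)
open import Data.Nat using (ℕ; zero; suc; _+_; _≤_; z≤n; s≤s)
open import Data.Nat.Properties using (suc-injective; +-comm)
open import Data.Product using (∃-syntax; _×_; _,_; proj₁; proj₂)
open import Data.Sum using (_⊎_; inj₁; inj₂)
open import Data.Vec
  using (Vec; []; _∷_; _++_; head; tail; lookup; updateAt; zipWith; cast; insertAt; removeAt; map)
open import Data.Vec.Properties
  using (insertAt-lookup; insertAt-punchIn; insertAt-removeAt; removeAt-insertAt;
         lookup-map; lookup∘updateAt; lookup∘updateAt′)
open import Function using (_∘_; id)
open import Relation.Binary.PropositionalEquality
  using (_≡_; _≢_; refl; sym; trans; cong; cong₂; subst; module ≡-Reasoning)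
open import Relation.Nullary using (¬_; yes; no; contradiction)
open import Relation.Unary using (_∈_; _⊆_; _≐_; _∪_; _⊥_)
open import Relation.Unary.Properties using (≐-sym)

private
  variable
    d k : ℕ
    A B C : Set

≢-≢⇒≡ : {a b c : Fin 2} → a ≢ c → b ≢ c → a ≡ b
≢-≢⇒≡ {0F} {0F}      _ _ = refl
≢-≢⇒≡ {1F} {1F}      _ _ = refl
≢-≢⇒≡ {0F} {1F} {0F} p _ = contradiction refl p
≢-≢⇒≡ {0F} {1F} {1F} _ q = contradiction refl q
≢-≢⇒≡ {1F} {0F} {0F} _ q = contradiction refl q
≢-≢⇒≡ {1F} {0F} {1F} p _ = contradiction refl p

opposite-≢ : (a : Fin 2) → opposite a ≢ a
opposite-≢ 0F ()
opposite-≢ 1F ()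

-- Vectors with a distinguished coordinate

punchIn-elim : (h : Fin (suc k)) (P : Fin (suc k) → Set) →
               P h → (∀ j → P (punchIn h j)) → ∀ i → P i
punchIn-elim zero P p q zero = p
punchIn-elim zero P p q (suc i) = q i
punchIn-elim {suc k} (suc h) P p q zero = q zero
punchIn-elim {suc k} (suc h) P p q (suc i) =
  punchIn-elim h (P ∘ suc) p (q ∘ suc) i

lookup-removeAt : (xs : Vec A (suc k)) (h : Fin (suc k)) (j : Fin k) →
                  lookup (removeAt xs h) j ≡ lookup xs (punchIn h j)
lookup-removeAt xs h j = trans
  (sym (insertAt-punchIn (removeAt xs h) h (lookup xs h) j))
  (cong (λ ys → lookup ys (punchIn h j)) (insertAt-removeAt xs h))

zipWith-insertAt : (f : A → B → C) (xs : Vec A k) (ys : Vec B k) (h : Fin (suc k)) (x : A) (y : B) →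
                   zipWith f (insertAt xs h x) (insertAt ys h y) ≡ insertAt (zipWith f xs ys) h (f x y)
zipWith-insertAt f xs ys zero x y = refl
zipWith-insertAt f (x′ ∷ xs) (y′ ∷ ys) (suc h) x y =
  cong (f x′ y′ ∷_) (zipWith-insertAt f xs ys h x y)

insertAt-⊕ : (v : Vertex k) (h : Fin (suc k)) (b : Fin 2) (i : Fin k) →
             insertAt (v ⊕ i) h b ≡ insertAt v h b ⊕ punchIn h i
insertAt-⊕ v zero b i = refl
insertAt-⊕ (x ∷ v) (suc h) b zero = refl
insertAt-⊕ (x ∷ v) (suc h) b (suc i) = cong (x ∷_) (insertAt-⊕ v h b i)

insertAt-⊕-at : (v : Vertex k) (h : Fin (suc k)) (b : Fin 2) →
                insertAt v h b ⊕ h ≡ insertAt v h (opposite b)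
insertAt-⊕-at v zero b = refl
insertAt-⊕-at (x ∷ v) (suc h) b = cong (x ∷_) (insertAt-⊕-at v h b)

-- `splice` on the first dimension of a two-letter string puts the other letter after `t`. This
-- turns that form into an insertion at the last coordinate.
cast-++-singleton : .(eq : d + 1 ≡ suc d) (t : Vec A d) (x : A) →
                    cast eq (t ++ x ∷ []) ≡ insertAt t (fromℕ d) x
cast-++-singleton eq [] x = refl
cast-++-singleton eq (y ∷ t) x = cong (y ∷_) (cast-++-singleton (suc-injective eq) t x)

-- Sinks

-- The condition on one coordinate of a sink: given the face symbol, the bit of
-- the vertex and its direction bit, either the face fixes the bit, or the edge is
-- incoming, which in the encoding of directions means that the two bits agree.
Settled : Maybe (Fin 2) → Fin 2 → Fin 2 → Set
Settled (just a) b _ = b ≡ a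
Settled nothing  b x = b ≡ x

record AllSettled (f : Vec (Maybe (Fin 2)) k) (v x : Vertex k) : Set where
  constructor settled
  field
    at : ∀ i → Settled (lookup f i) (lookup v i) (lookup x i)

open AllSettled

-- Flipping a free coordinate stays in the face, so the edge there lies inside it and cannot be
-- outgoing.
sink⇒settled : (O : Orientation k) {f : Vec (Maybe (Fin 2)) k} {v : Vertex k} →
               SinkOf O f v → AllSettled f v (dir O v)
at (sink⇒settled O {f} {v} (v∈f , stuck)) i with lookup f i in fᵢ
... | just a  = v∈f i a fᵢ
... | nothing = incoming (lookup v i) (lookup (dir O v) i) (stuck i v⊕i∈f)
  where
  v⊕i∈f : v ⊕ i ∈ Face f
  v⊕i∈f j b fⱼ with j ≟ i
  ... | yes refl = contradiction (trans (sym fᵢ) fⱼ) λ ()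
  ... | no j≢i = trans (lookup∘updateAt′ j i j≢i v) (v∈f j b fⱼ)
  incoming : ∀ b x → ¬ ((b ≡ 0F × x ≡ 1F) ⊎ (b ≡ 1F × x ≡ 0F)) → b ≡ x
  incoming 0F 0F _ = refl
  incoming 1F 1F _ = refl
  incoming 0F 1F p = contradiction (inj₁ (refl , refl)) p
  incoming 1F 0F p = contradiction (inj₂ (refl , refl)) p

settled⇒sink : (O : Orientation k) {f : Vec (Maybe (Fin 2)) k} {v : Vertex k} →
               AllSettled f v (dir O v) → SinkOf O f v
settled⇒sink O {f} {v} (settled s) = v∈f , stuck
  where
  v∈f : v ∈ Face f
  v∈f i b fᵢ = subst (λ c → Settled c (lookup v i) (lookup (dir O v) i)) fᵢ (s i)
  ¬outgoing : ∀ i → lookup v i ≡ lookup (dir O v) i → ¬ Outgoing O v i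
  ¬outgoing i eq (inj₁ (p , q)) = 0≢1+n (trans (sym p) (trans eq q))
  ¬outgoing i eq (inj₂ (p , q)) = 0≢1+n (trans (sym q) (trans (sym eq) p))
  stuck : ∀ i → v ⊕ i ∈ Face f → ¬ Outgoing O v i
  stuck i v⊕i∈f with lookup f i in fᵢ | s i
  -- Flipping a fixed coordinate leaves the face, so `v⊕i∈f` is absurd.
  ... | just a  | p = λ _ → opposite-≢ (lookup v i)
    (trans (sym (lookup∘updateAt i v)) (trans (v⊕i∈f i a fᵢ) (sym p)))
  ... | nothing | p = ¬outgoing i p

module _ (h : Fin (suc k)) {f : Vec (Maybe (Fin 2)) k} {v x : Vertex k}
         {c : Maybe (Fin 2)} {b y : Fin 2} where

  private
    SettledAt : Fin (suc k) → Set
    SettledAt i = Settled (lookup (insertAt f h c) i) (lookup (insertAt v h b) i) (lookup (insertAt x h y) i)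

    settledAt-h : SettledAt h ≡ Settled c b y
    settledAt-h rewrite insertAt-lookup f h c | insertAt-lookup v h b | insertAt-lookup x h y = refl

    settledAt-punchIn : ∀ j → SettledAt (punchIn h j) ≡ Settled (lookup f j) (lookup v j) (lookup x j)
    settledAt-punchIn j rewrite insertAt-punchIn f h c j | insertAt-punchIn v h b j | insertAt-punchIn x h y j = refl

  settled-insertAt⁺ : Settled c b y → AllSettled f v x →
                      AllSettled (insertAt f h c) (insertAt v h b) (insertAt x h y)
  settled-insertAt⁺ p (settled q) = settled (punchIn-elim h SettledAt
    (subst id (sym settledAt-h) p) (λ j → subst id (sym (settledAt-punchIn j)) (q j)))

  settled-insertAt⁻ : AllSettled (insertAt f h c) (insertAt v h b) (insertAt x h y) →
                      Settled c b y × AllSettled f v x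
  settled-insertAt⁻ (settled s) =
    subst id settledAt-h (s h) , settled λ j → subst id (settledAt-punchIn j) (s (punchIn h j))

edgeFace : Vertex k → Fin k → Vec (Maybe (Fin 2)) k
edgeFace v i = updateAt (map just v) i (λ _ → nothing)

settled-edgeFace : (v : Vertex k) (i : Fin k) {w x : Vertex k} →
                   (∀ j → j ≢ i → lookup w j ≡ lookup v j) → lookup w i ≡ lookup x i →
                   AllSettled (edgeFace v i) w x
at (settled-edgeFace v i agree incoming) j with j ≟ i
... | yes refl rewrite lookup∘updateAt i {λ _ → nothing} (map just v) = incoming
... | no j≢i rewrite lookup∘updateAt′ j i {λ _ → nothing} j≢i (map just v)
                   | lookup-map j just v = agree j j≢i

-- Facets and mixtures of two opposite facets

module Facets (O : Orientation (suc d)) (h : Fin (suc d)) where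

  facet : Fin 2 → Orientation d
  dir (facet b) v = removeAt (dir O (insertAt v h b)) h
  consistent (facet b) v i = begin
    lookup (removeAt (dir O w) h) i                           ≡⟨ lookup-removeAt (dir O w) h i ⟩
    lookup (dir O w) (punchIn h i)                            ≡⟨ consistent O w (punchIn h i) ⟩
    lookup (dir O (w ⊕ punchIn h i)) (punchIn h i)            ≡⟨ cong (λ w′ → lookup (dir O w′) (punchIn h i)) (insertAt-⊕ v h b i) ⟨
    lookup (dir O (insertAt (v ⊕ i) h b)) (punchIn h i)       ≡⟨ lookup-removeAt (dir O (insertAt (v ⊕ i) h b)) h i ⟨
    lookup (removeAt (dir O (insertAt (v ⊕ i) h b)) h) i      ∎
    where
    open ≡-Reasoning
    w = insertAt v h b

  edge : Vertex d → Fin 2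
  edge u = lookup (dir O (insertAt u h 0F)) h

  lookup-dir-h : ∀ u b → lookup (dir O (insertAt u h b)) h ≡ edge u
  lookup-dir-h u 0F = refl
  lookup-dir-h u 1F = sym (trans (consistent O (insertAt u h 0F) h)
    (cong (λ w → lookup (dir O w) h) (insertAt-⊕-at u h 0F)))

  dir-insertAt : ∀ u b → dir O (insertAt u h b) ≡ insertAt (dir (facet b) u) h (edge u)
  dir-insertAt u b = trans
    (sym (insertAt-removeAt (dir O (insertAt u h b)) h))
    (cong (insertAt (dir (facet b) u) h) (lookup-dir-h u b))

  encode-insertAt : ∀ u b → encode O (insertAt u h b) ≡ insertAt (encode (facet b) u) h (combine b (edge u))
  encode-insertAt u b = trans
    (cong (zipWith combine (insertAt u h b)) (dir-insertAt u b))
    (zipWith-insertAt combine u (dir (facet b) u) h b (edge u))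

  -- Coordinate `h` is settled independently of the others. The choice `c = just b` keeps the face
  -- inside one facet; `c = nothing` gives the product of `f` with an edge.
  facet-sink⁺ : ∀ {f c u} b → Settled c b (edge u) → SinkOf (facet b) f u →
                SinkOf O (insertAt f h c) (insertAt u h b)
  facet-sink⁺ {u = u} b p s = settled⇒sink O
    (subst (AllSettled _ _) (sym (dir-insertAt u b))
      (settled-insertAt⁺ h p (sink⇒settled (facet b) s)))

  facet-sink⁻ : ∀ {f c u} b → SinkOf O (insertAt f h c) (insertAt u h b) →
                Settled c b (edge u) × SinkOf (facet b) f u
  facet-sink⁻ {u = u} b s =
    let p , q = settled-insertAt⁻ h (subst (AllSettled _ _) (dir-insertAt u b) (sink⇒settled O s))
    in  p , settled⇒sink (facet b) q

  insertAt-surjective : ∀ (w : Vertex (suc d)) → ∃[ u ] ∃[ b ] w ≡ insertAt u h b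
  insertAt-surjective w = removeAt w h , lookup w h , sym (insertAt-removeAt w h)

  insertAt-injective : ∀ {u u′ : Vertex d} {b b′} → insertAt u h b ≡ insertAt u′ h b′ → u ≡ u′ × b ≡ b′
  insertAt-injective {u} {u′} {b} {b′} eq =
    trans (sym (removeAt-insertAt u h b)) (trans (cong (λ w → removeAt w h) eq) (removeAt-insertAt u′ h b′)) ,
    trans (sym (insertAt-lookup u h b)) (trans (cong (λ w → lookup w h) eq) (insertAt-lookup u′ h b′))

  module _ (uso : UniqueSink O) where

    unique-sink-insertAt : ∀ f → ∃[ u ] ∃[ β ] SinkOf O f (insertAt u h β) ×
      (∀ {u′ β′} → SinkOf O f (insertAt u′ h β′) → u ≡ u′ × β ≡ β′)
    unique-sink-insertAt f =
      let w , s , unique = uso f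
          u , β , eq     = insertAt-surjective w
      in  u , β , subst (SinkOf O f) eq s , λ t → insertAt-injective (trans (sym eq) (unique t))

    facet-unique : ∀ b → UniqueSink (facet b)
    facet-unique b f with u , β , s , unique ← unique-sink-insertAt (insertAt f h (just b))
      with refl , t ← facet-sink⁻ {f} {just b} β s
      = u , t , λ t′ → proj₁ (unique (facet-sink⁺ b refl t′))

    -- ε is the h-coordinate of the sink of f × {0,1}.
    facet-sinks-same-edge : ∀ f → ∃[ ε ] (∀ b {a} → SinkOf (facet b) f a → edge a ≡ ε)
    facet-sinks-same-edge f with u , β , s , unique ← unique-sink-insertAt (insertAt f h nothing)
      with β≡edge , t ← facet-sink⁻ {f} {nothing} β s
      = β , same
      where
      same : ∀ b {a} → SinkOf (facet b) f a → edge a ≡ β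
      same b {a} sa with edge a ≟ b
      -- The edge over `a` is incoming at side `b`, so `a` lifts to the unique sink of the product
      -- face.
      ... | yes e = trans e (sym (proj₂ (unique (facet-sink⁺ b (sym e) sa))))
      -- Here `b` differs from `β`: in `facet β` the only sink of `f` is `u`, and `edge u` is `β`.
      -- Two bits that both differ from `b` agree.
      ... | no e≢b = ≢-≢⇒≡ e≢b λ where
        refl → let _ , _ , unique-b = facet-unique b f in
          e≢b (trans (cong edge (trans (sym (unique-b sa)) (unique-b t))) (sym β≡edge))

    -- The `i`-edge at `v` is itself a face; its sink is `v` in `facet b` and `v ⊕ i` in `facet b′`.
    crossing-edges-same : ∀ v i b b′ →
      lookup v i ≡ lookup (dir (facet b) v) i → lookup v i ≢ lookup (dir (facet b′) v) i →
      edge v ≡ edge (v ⊕ i)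
    crossing-edges-same v i b b′ p q =
      let _ , same = facet-sinks-same-edge (edgeFace v i)
      in  trans (same b sink) (sym (same b′ sink′))
      where
      sink : SinkOf (facet b) (edgeFace v i) v
      sink = settled⇒sink (facet b) (settled-edgeFace v i (λ _ _ → refl) p)
      sink′ : SinkOf (facet b′) (edgeFace v i) (v ⊕ i)
      sink′ = settled⇒sink (facet b′) (settled-edgeFace v i
        (λ j j≢i → lookup∘updateAt′ j i j≢i v)
        (trans (≢-≢⇒≡ (λ eq → opposite-≢ _ (trans (sym (lookup∘updateAt i v)) eq)) (q ∘ sym))
               (consistent (facet b′) v i)))

    -- If `v` were the sink of its `i`-edge in only one of the facets, `crossing-edges-same` would
    -- equate the two `edge` values. This gives consistency of `mixture` where the endpoints copy
    -- different facets.
    opposite-edges⇒facets-agree : ∀ v i → edge v ≢ edge (v ⊕ i) → ∀ b b′ →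
      lookup (dir (facet b) v) i ≡ lookup (dir (facet b′) v) i
    opposite-edges⇒facets-agree v i e≢ b b′
      with lookup v i ≟ lookup (dir (facet b) v) i | lookup v i ≟ lookup (dir (facet b′) v) i
    ... | yes p | yes q = trans (sym p) q
    ... | yes p | no q  = contradiction (crossing-edges-same v i b b′ p q) e≢
    ... | no p  | yes q = contradiction (crossing-edges-same v i b′ b q p) e≢
    ... | no p  | no q  = ≢-≢⇒≡ (p ∘ sym) (q ∘ sym)

    -- The four functions `g` correspond to the four pairs of labels that a rewriting rule with two
    -- labels has to handle.
    mixture : (Fin 2 → Fin 2) → Orientation d
    dir (mixture g) v = dir (facet (g (edge v))) v
    consistent (mixture g) v i with edge v ≟ edge (v ⊕ i)
    ... | yes eq = trans (consistent (facet (g (edge v))) v i)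
                         (cong (λ e → lookup (dir (facet (g e)) (v ⊕ i)) i) eq)
    ... | no e≢  = trans (opposite-edges⇒facets-agree v i e≢ _ (g (edge (v ⊕ i))))
                         (consistent (facet (g (edge (v ⊕ i)))) v i)

    -- SinkOf (mixture g) f v unfolds to SinkOf (facet (g (edge v))) f v.
    mixture-unique : ∀ g → UniqueSink (mixture g)
    mixture-unique g f =
      let ε , same       = facet-sinks-same-edge f
          a , s , unique = facet-unique (g ε) f
      in  a , subst (λ e → SinkOf (facet (g e)) f a) (sym (same (g ε) s)) s ,
          -- `same` covers both facets, so it gives `edge y` the value `ε` whichever facet `y`
          -- copies.
          λ {y} t → unique (subst (λ e → SinkOf (facet (g e)) f y) (same (g (edge y)) t) t)

-- The rewriting rule

-- A letter determines its vertex bit whatever the direction bit, so strings of different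
-- orientations can be compared.
encode-injective : (O O′ : Orientation k) {u u′ : Vertex k} → encode O u ≡ encode O′ u′ → u ≡ u′
encode-injective O O′ = zipWith-combine-injectiveˡ _ _ _ _
  where
  zipWith-combine-injectiveˡ : ∀ {n} (u x u′ x′ : Vertex n) →
    zipWith combine u x ≡ zipWith combine u′ x′ → u ≡ u′
  zipWith-combine-injectiveˡ [] [] [] [] _ = refl
  zipWith-combine-injectiveˡ (a ∷ u) (b ∷ x) (a′ ∷ u′) (b′ ∷ x′) eq =
    cong₂ _∷_ (combine-injectiveˡ a b a′ b′ (cong head eq)) (zipWith-combine-injectiveˡ u x u′ x′ (cong tail eq))

module Splitting (O : Orientation (suc d)) (uso : UniqueSink O) where

  -- The last coordinate, because rewriting the first letter of a bow string leaves its second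
  -- letter at the end.
  open Facets O (fromℕ d)

  part : Fin 2 → Fin 2 → StringSet d
  part e j s = ∃[ u ] edge u ≡ e × s ≡ encode (facet j) u

  part⊆facet : ∀ e j → part e j ⊆ Encoding (facet j)
  part⊆facet e j (u , _ , eq) = u , eq

  -- A common string would come from a single vertex, whose edge would point both up and down.
  part-disjoint : ∀ j j′ → part 1F j ⊥ part 0F j′
  part-disjoint j j′ ((u , up , eq) , (u′ , down , eq′)) =
    0≢1+n (trans (sym down) (trans (cong edge (encode-injective (facet j′) (facet j) (trans (sym eq′) eq))) up))

  part-USO : ∀ j j′ → IsUSO (part 1F j ∪ part 0F j′)
  part-USO j j′ = mixture uso g , mixture-unique uso g , to , from
    where
    g : Fin 2 → Fin 2
    g 0F = j′
    g 1F = j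
    to : part 1F j ∪ part 0F j′ ⊆ Encoding (mixture uso g)
    to (inj₁ (u , up , eq))   = u , trans eq (cong (λ e → encode (facet (g e)) u) (sym up))
    to (inj₂ (u , down , eq)) = u , trans eq (cong (λ e → encode (facet (g e)) u) (sym down))
    from : Encoding (mixture uso g) ⊆ part 1F j ∪ part 0F j′
    from (u , eq) with edge u in e
    ... | 0F = inj₂ (u , e , eq)
    ... | 1F = inj₁ (u , e , eq)

  -- In the bow, a string beginning with m stands for upward edges if m is 0 or 1
  -- and for downward edges if m is 2 or 3.
  rule : RewritingRule d 2
  S rule m = part (opposite (quotient {2} 2 m))
  disjoint₀₂ rule = part-disjoint
  uso₀₂      rule = part-USO
  disjoint₁₃ rule = part-disjoint
  uso₁₃      rule = part-USO

  -- The second letter of a bow string is `combine b e`, where `e` is the direction its first letter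
  -- stands for; the label is the facet `b`.
  facetLabel : Labelling bow 2
  facetLabel v _ = quotient {2} 2 (lookup v 1F)

  -- The four bow strings run once through all pairs of a direction `e` and a facet `b`, and each
  -- contributes the strings of `O` ending in `combine b e`.
  apply-rule : apply rule 0F bow facetLabel ≐ Encoding O
  apply-rule = to , from
    where
    to-part : ∀ e b {t} → t ∈ part e b → cast (+-comm d 1) (t ++ combine b e ∷ []) ∈ Encoding O
    to-part e b {t} (u , refl , refl) =
      insertAt u (fromℕ d) b , trans (cast-++-singleton (+-comm d 1) t _) (sym (encode-insertAt u b))
    to : apply rule 0F bow facetLabel ⊆ Encoding O
    to (_ , here refl , t , p , refl)                         = to-part 1F 0F p
    to (_ , there (here refl) , t , p , refl)                 = to-part 0F 0F p
    to (_ , there (there (here refl)) , t , p , refl)         = to-part 1F 1F p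
    to (_ , there (there (there (here refl))) , t , p , refl) = to-part 0F 1F p
    from : Encoding O ⊆ apply rule 0F bow facetLabel
    from (w , refl) =
      let u , b , eq = insertAt-surjective w
      in  subst (_∈ apply rule 0F bow facetLabel)
            (trans (cast-++-singleton (+-comm d 1) (encode (facet b) u) _)
                   (trans (sym (encode-insertAt u b)) (cong (encode O) (sym eq))))
            (from-part (edge u) b (u , refl , refl))
      where
      from-part : ∀ e b {t} → t ∈ part e b →
                  cast (+-comm d 1) (t ++ combine b e ∷ []) ∈ apply rule 0F bow facetLabel
      from-part 1F 0F p = _ , here refl , _ , p , refl
      from-part 0F 0F p = _ , there (here refl) , _ , p , refl
      from-part 1F 1F p = _ , there (there (here refl)) , _ , p , refl
      from-part 0F 1F p = _ , there (there (there (here refl))) , _ , p , refl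

-- Dimension one and the induction on the dimension

edgeStrings : Fin 2 → StringSet 1
edgeStrings b = ⟪ (combine {2} 0F b ∷ []) List.∷ (combine {2} 1F b ∷ []) List.∷ List.[] ⟫

encoding₁ : (O : Orientation 1) → Encoding O ∈ 𝒰
encoding₁ O with dir O (0F ∷ []) in eq₀ | dir O (1F ∷ []) in eq₁ | consistent O (0F ∷ []) 0F
-- Consistency along the only edge forces both endpoints to carry the same bit.
... | b ∷ [] | _ ∷ [] | refl = byDirection b eq₀ eq₁
  where
  encoded : ∀ b → dir O (0F ∷ []) ≡ b ∷ [] → dir O (1F ∷ []) ≡ b ∷ [] →
            edgeStrings b ≐ Encoding O
  encoded b eq₀ eq₁ = to , from
    where
    to : edgeStrings b ⊆ Encoding O
    to (here refl)         = 0F ∷ [] , cong (zipWith combine (0F ∷ [])) (sym eq₀)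
    to (there (here refl)) = 1F ∷ [] , cong (zipWith combine (1F ∷ [])) (sym eq₁)
    from : Encoding O ⊆ edgeStrings b
    from (0F ∷ [] , refl) = here (cong (zipWith combine (0F ∷ [])) eq₀)
    from (1F ∷ [] , refl) = there (here (cong (zipWith combine (1F ∷ [])) eq₁))
  byDirection : ∀ b → dir O (0F ∷ []) ≡ b ∷ [] → dir O (1F ∷ []) ≡ b ∷ [] → Encoding O ∈ 𝒰
  -- `edgeStrings 0F` computes to the set of `base₀₂`, and `edgeStrings 1F` to that of `base₁₃`.
  byDirection 0F eq₀ eq₁ = resp (encoded 0F eq₀ eq₁) base₀₂
  byDirection 1F eq₀ eq₁ = resp (encoded 1F eq₀ eq₁) base₁₃

encoding : ∀ d (O : Orientation (suc d)) → UniqueSink O → Encoding O ∈ 𝒰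
encoding zero O uso = encoding₁ O
encoding (suc d) O uso = resp apply-rule
  (rewrite-bow (s≤s z≤n) (s≤s z≤n) rule
    -- The obtained USO containing `S rule m j` is the whole facet `j`, for every `m`; it lies in
    -- `𝒰` by induction.
    (λ m j → Encoding (facet j) , encoding d (facet j) (facet-unique uso j) , part⊆facet _ j)
    facetLabel 0F)
  where
  open Facets O (fromℕ (suc d))
  open Splitting O uso

theorem24 : (n : ℕ) → 1 ≤ n → (K : StringSet n) → IsUSO K → K ∈ 𝒰
theorem24 (suc d) _ K (O , uso , K≐O) = resp (≐-sym K≐O) (encoding d O uso)
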